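{- Let $P,P'$ be $\pi\ell$ processes, $\Gamma$ a typing environment and $\mathbb{R}$ a set of lock names. If $\Gamma;\mathbb{R}\vdash P$ and $P\Rightarrow P'$, then $P'$ is not deadlocked.
   Context: **Processes of $\pi\ell$.** Fix an infinite set of lock names $\ell,\ell',\ell_1,x,y,\dots$. Values are $v::=\ell\mid \mathtt{b}$ with $\mathtt{b}::=\mathsf{tt}\mid\mathsf{ff}$ a boolean. Processes: $P::=\ell(\ell').P\mid\overline{\ell}\langle v\rangle\mid(\nu\ell)P\mid P_1|P_2\mid\mathbf{0}\mid[v=v']P_1,P_2$. Here $\overline{\ell}\langle v\rangle$ is a release of $\ell$ and $\ell(\ell').P$ is an acquire on $\ell$, binding $\ell'$ in $P$; $(\nu\ell)P$ binds $\ell$ in $P$; bound names are considered up to renaming. $\mathrm{fln}(P)$ is the set of free lock names of $P$, and $P\{v/\ell\}$ is substitution. A sorting discipline is implicit: sorts are $V::=\mathsf{bool}\mid L$ with $\Sigma(L)=V$ giving the sort of the values stored in locks of sort $L$; all processes obey it, and in $[v=v']P_1,P_2$ the values $v,v'$ have the same sort. **Structural congruence $\equiv$** is the smallest equivalence satisfying: $P|Q\equiv Q|P$; $P|(Q|R)\equiv(P|Q)|R$; $P|(\nu\ell)Q\equiv(\nu\ell)(P|Q)$ if $\ell\notin\mathrm{fln}(P)$; $(\nu\ell)(\nu\ell')P\equiv(\nu\ell')(\nu\ell)P$; $P|\mathbf 0\equiv P$; $(\nu\ell)\mathbf 0\equiv\mathbf 0$; $[v=v]P_1,P_2\equiv P_1$;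 $[v=v']P_1,P_2\equiv P_2$ if $v\neq v'$; closed under $\cdot|T$, under $(\nu\ell)\cdot$, and such that $P\equiv_r Q$ implies $\ell(\ell').P\equiv\ell(\ell').Q$. The relation $\equiv_r$ is defined in the same way, except that the axiom for $v\neq v'$ is omitted and closure under acquire is: $P\equiv_r Q$ implies $\ell(\ell').P\equiv_r\ell(\ell').Q$. **Reduction.** $\overline{\ell}\langle v\rangle\,|\,\ell(\ell').P\to P\{v/\ell'\}$, closed under execution contexts $E::=[\cdot]\mid E|P\mid(\nu\ell)E$ and under $\equiv$. $\Rightarrow$ is the reflexive transitive closure of $\to$. **Typing.** A component $\gamma$ is a set of lock names; $\gamma_1\#\gamma_2$ means $\gamma_1\cap\gamma_2=\emptyset$. A typing environment $\Gamma$ is a finite set of pairwise disjoint components. $\gamma,\ell$ denotes $\gamma\uplus\{\ell\}$ (so $\ell\notin\gamma$), $\Gamma,\gamma$ denotes $\Gamma\uplus\{\gamma\}$ (with $\gamma$ disjoint from all components of $\Gamma$), and $\mathbb{R},\ell$ denotes $\mathbb{R}\uplus\{\ell\}$ (so $\ell\notin\mathbb{R}$); $\gamma,\ell,\ell'$ requires $\ell\ne\ell'$ and both not in $\gamma$. Convention: $\gamma,v$ is just $\gamma$ if $v$ is a boolean, and $\gamma,\ell$ is just $\gamma$ if the sort of $\ell$ is $\mathsf{bool}$. $\mathsf{flatten}(\{\gamma_1,\dots,\gamma_k\})=\gamma_1\uplus\dots\uplus\gamma_k$. Composition: $\emptyset\bullet\Gamma=\Gamma$ and $(\Gamma,\gamma)\bullet\Gamma'=\mathsf{connect}(\gamma;\Gamma\bullet\Gamma')$,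 where $\mathsf{connect}(\gamma;\{\gamma_1,\dots,\gamma_k\})$ is undefined if some $\gamma\cap\gamma_i$ has at least two distinct elements, and otherwise equals $\{\gamma_i:\gamma_i\#\gamma\}\uplus\{\gamma\cup\mathsf{flatten}(\{\gamma_i:\gamma_i\cap\gamma\neq\emptyset\})\}$. Judgements $\Gamma;\mathbb{R}\vdash P$, with $\mathbb{R}$ a set of lock names, are derived by: (Acq) if $\Gamma,(\gamma,\ell,\ell');\mathbb{R},\ell\vdash P$ then $\{\mathsf{flatten}(\Gamma)\uplus(\gamma,\ell)\};\mathbb{R}\vdash\ell(\ell').P$; (Rel) $\Gamma,(\gamma,\ell,v);\{\ell\}\vdash\overline{\ell}\langle v\rangle$; (New) if $\Gamma,(\gamma,\ell);\mathbb{R},\ell\vdash P$ then $\Gamma,\gamma;\mathbb{R}\vdash(\nu\ell)P$; (Par) if $\Gamma_1;\mathbb{R}_1\vdash P_1$ and $\Gamma_2;\mathbb{R}_2\vdash P_2$ then $\Gamma_1\bullet\Gamma_2;\mathbb{R}_1\uplus\mathbb{R}_2\vdash P_1|P_2$ (when $\Gamma_1\bullet\Gamma_2$ is defined and $\mathbb{R}_1\cap\mathbb{R}_2=\emptyset$); (Mat) if $\Gamma;\mathbb{R}\vdash P_1$ and $\Gamma;\mathbb{R}\vdash P_2$ then $\Gamma;\mathbb{R}\vdash[v=v']P_1,P_2$ (no condition on $v,v'$); (Nil) $\Gamma;\emptyset\vdash\mathbf 0$. **Deadlock.** $P$ is complete if $\Gamma;\mathrm{fln}(P)\vdash P$ for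 some $\Gamma$. $P$ is stuck if it contains at least one acquire (containment being understood up to $\equiv$, i.e. every process structurally congruent to $P$ contains an acquire) and cannot reduce. $P$ is deadlocked if it is complete and stuck. -}

module Defs where

open import Data.Bool.Base using (Bool)
open import Data.Fin.Base using (Fin; zero; suc)
open import Data.Fin.Subset
  using (Subset; Side; inside; outside; ⊥; ⁅_⁆; _∈_; _∉_; _∩_; _∪_; ⋃; ∣_∣; Empty; Nonempty)
open import Data.Fin.Subset.Properties using (nonempty?)
open import Data.List.Base using (List; []; _∷_; map; filter)
open import Data.List.Relation.Binary.BagAndSetEquality using (_∼[_]_; set)
open import Data.List.Relation.Unary.All using (All)
open import Data.List.Relation.Unary.AllPairs using (AllPairs)
open import Data.Nat.Base using (ℕ; zero; suc; _≤_)
open import Data.Product.Base using (∃-syntax; _×_)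
open import Data.Vec.Base using (_∷_; tail)
open import Relation.Binary.Construct.Closure.ReflexiveTransitive using (Star)
open import Relation.Binary.PropositionalEquality.Core using (_≢_)
open import Relation.Nullary.Negation.Core using (¬_)
open import Relation.Nullary.Decidable using (¬?)

data Sort (𝕃 : Set) : Set where
  bool : Sort 𝕃
  lock : (L : 𝕃) → Sort 𝕃

-- The calculus πℓ over a sorting: a set 𝕃 of lock sorts, and for each of them
-- the sort Σ L of the values stored in the locks of sort L.  Processes are
-- intrinsically sorted and use well-scoped de Bruijn indices, so that bound
-- names are identified up to renaming.

module πℓ {𝕃 : Set} (Σ : 𝕃 → Sort 𝕃) where

  -- The sorts of the names in scope.  A name of sort bool stands for a boolean
  -- (it can only be bound by an acquire on a lock storing booleans); the names
  -- of sort lock L are the locks.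

  Ctx : Set
  Ctx = List (Sort 𝕃)

  infix 4 _∋_

  data _∋_ : Ctx → Sort 𝕃 → Set where
    Z : ∀ {Δ s} → s ∷ Δ ∋ s
    S : ∀ {Δ s t} → Δ ∋ s → t ∷ Δ ∋ s

  data Val (Δ : Ctx) : Sort 𝕃 → Set where
    name : ∀ {s} → Δ ∋ s → Val Δ s
    lit  : Bool → Val Δ bool

  infixr 5 _∥_

  data Proc (Δ : Ctx) : Set where
    acquire : ∀ {L} → Δ ∋ lock L → Proc (Σ L ∷ Δ) → Proc Δ
    release : ∀ {L} → Δ ∋ lock L → Val Δ (Σ L) → Proc Δ
    ν       : (L : 𝕃) → Proc (lock L ∷ Δ) → Proc Δ
    _∥_     : Proc Δ → Proc Δ → Proc Δ
    𝟎       : Proc Δ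
    match   : ∀ {s} → Val Δ s → Val Δ s → Proc Δ → Proc Δ → Proc Δ

  ----------------------------------------------------------------------
  -- Renaming and substitution

  Ren : Ctx → Ctx → Set
  Ren Δ Δ′ = ∀ {s} → Δ ∋ s → Δ′ ∋ s

  extᴿ : ∀ {Δ Δ′ t} → Ren Δ Δ′ → Ren (t ∷ Δ) (t ∷ Δ′)
  extᴿ ρ Z     = Z
  extᴿ ρ (S x) = S (ρ x)

  renVal : ∀ {Δ Δ′ s} → Ren Δ Δ′ → Val Δ s → Val Δ′ s
  renVal ρ (name x) = name (ρ x)
  renVal ρ (lit b)  = lit b

  ren : ∀ {Δ Δ′} → Ren Δ Δ′ → Proc Δ → Proc Δ′
  ren ρ (acquire ℓ P)     = acquire (ρ ℓ) (ren (extᴿ ρ) P)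
  ren ρ (release ℓ v)     = release (ρ ℓ) (renVal ρ v)
  ren ρ (ν L P)           = ν L (ren (extᴿ ρ) P)
  ren ρ (P ∥ Q)           = ren ρ P ∥ ren ρ Q
  ren ρ 𝟎                 = 𝟎
  ren ρ (match v v′ P Q)  = match (renVal ρ v) (renVal ρ v′) (ren ρ P) (ren ρ Q)

  weaken : ∀ {Δ} t → Proc Δ → Proc (t ∷ Δ)
  weaken t = ren S

  swap : ∀ {Δ t u} → Ren (t ∷ u ∷ Δ) (u ∷ t ∷ Δ)
  swap Z         = S Z
  swap (S Z)     = Z
  swap (S (S x)) = S (S x)

  Sub : Ctx → Ctx → Set
  Sub Δ Δ′ = ∀ {s} → Δ ∋ s → Val Δ′ s

  extˢ : ∀ {Δ Δ′ t} → Sub Δ Δ′ → Sub (t ∷ Δ) (t ∷ Δ′)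
  extˢ σ Z     = name Z
  extˢ σ (S x) = renVal S (σ x)

  subVal : ∀ {Δ Δ′ s} → Sub Δ Δ′ → Val Δ s → Val Δ′ s
  subVal σ (name x) = σ x
  subVal σ (lit b)  = lit b

  toLock : ∀ {Δ L} → Val Δ (lock L) → Δ ∋ lock L
  toLock (name ℓ) = ℓ

  sub : ∀ {Δ Δ′} → Sub Δ Δ′ → Proc Δ → Proc Δ′
  sub σ (acquire ℓ P)     = acquire (toLock (σ ℓ)) (sub (extˢ σ) P)
  sub σ (release ℓ v)     = release (toLock (σ ℓ)) (subVal σ v)
  sub σ (ν L P)           = ν L (sub (extˢ σ) P)
  sub σ (P ∥ Q)           = sub σ P ∥ sub σ Q
  sub σ 𝟎                 = 𝟎
  sub σ (match v v′ P Q)  = match (subVal σ v) (subVal σ v′) (sub σ P) (sub σ Q)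

  single : ∀ {Δ t} → Val Δ t → Sub (t ∷ Δ) Δ
  single v Z     = v
  single v (S x) = name x

  infix 8 _[_]

  _[_] : ∀ {Δ t} → Proc (t ∷ Δ) → Val Δ t → Proc Δ
  P [ v ] = sub (single v) P

  ----------------------------------------------------------------------
  -- Structural congruence

  -- The modes ≡-mode and ≡ᵣ-mode give the relations ≡ and ≡ᵣ: only the former
  -- has the mismatch axiom, and both are closed under acquire from ≡ᵣ.

  data Mode : Set where
    ≡-mode ≡ᵣ-mode : Mode

  infix 4 _▷_≈_ _≡ˢ_ _≡ᵣ_

  data _▷_≈_ : Mode → ∀ {Δ} → Proc Δ → Proc Δ → Set where
    ≈-refl  : ∀ {m Δ} {P : Proc Δ} → m ▷ P ≈ P
    ≈-sym   : ∀ {m Δ} {P Q : Proc Δ} → m ▷ P ≈ Q → m ▷ Q ≈ P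
    ≈-trans : ∀ {m Δ} {P Q T : Proc Δ} → m ▷ P ≈ Q → m ▷ Q ≈ T → m ▷ P ≈ T

    ∥-comm  : ∀ {m Δ} {P Q : Proc Δ} → m ▷ P ∥ Q ≈ Q ∥ P
    ∥-assoc : ∀ {m Δ} {P Q T : Proc Δ} → m ▷ P ∥ (Q ∥ T) ≈ (P ∥ Q) ∥ T
    ∥-ν     : ∀ {m Δ L} {P : Proc Δ} {Q : Proc (lock L ∷ Δ)} →
              m ▷ P ∥ ν L Q ≈ ν L (weaken (lock L) P ∥ Q)
    ν-ν     : ∀ {m Δ L L′} {P : Proc (lock L′ ∷ lock L ∷ Δ)} →
              m ▷ ν L (ν L′ P) ≈ ν L′ (ν L (ren swap P))
    ∥-𝟎     : ∀ {m Δ} {P : Proc Δ} → m ▷ P ∥ 𝟎 ≈ P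
    ν-𝟎     : ∀ {m Δ L} → m ▷ ν {Δ} L 𝟎 ≈ 𝟎
    match-≡ : ∀ {m Δ s} {v : Val Δ s} {P Q : Proc Δ} → m ▷ match v v P Q ≈ P
    match-≢ : ∀ {Δ s} {v v′ : Val Δ s} {P Q : Proc Δ} → v ≢ v′ →
              ≡-mode ▷ match v v′ P Q ≈ Q

    ∥-cong       : ∀ {m Δ} {P Q T : Proc Δ} → m ▷ P ≈ Q → m ▷ P ∥ T ≈ Q ∥ T
    ν-cong       : ∀ {m Δ L} {P Q : Proc (lock L ∷ Δ)} →
                   m ▷ P ≈ Q → m ▷ ν L P ≈ ν L Q
    acquire-cong : ∀ {m Δ L} {ℓ : Δ ∋ lock L} {P Q : Proc (Σ L ∷ Δ)} →
                   ≡ᵣ-mode ▷ P ≈ Q → m ▷ acquire ℓ P ≈ acquire ℓ Q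

  _≡ˢ_ _≡ᵣ_ : ∀ {Δ} → Proc Δ → Proc Δ → Set
  P ≡ˢ Q = ≡-mode ▷ P ≈ Q
  P ≡ᵣ Q = ≡ᵣ-mode ▷ P ≈ Q

  ----------------------------------------------------------------------
  -- Reduction

  infix 4 _⟶_ _⇒_

  data _⟶_ {Δ : Ctx} : Proc Δ → Proc Δ → Set where
    comm   : ∀ {L} {ℓ : Δ ∋ lock L} {v : Val Δ (Σ L)} {P : Proc (Σ L ∷ Δ)} →
             release ℓ v ∥ acquire ℓ P ⟶ P [ v ]
    par    : ∀ {P P′ Q : Proc Δ} → P ⟶ P′ → P ∥ Q ⟶ P′ ∥ Q
    res    : ∀ {L} {P P′ : Proc (lock L ∷ Δ)} → P ⟶ P′ → ν L P ⟶ ν L P′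
    struct : ∀ {P P′ Q Q′ : Proc Δ} → P ≡ˢ Q → Q ⟶ Q′ → Q′ ≡ˢ P′ → P ⟶ P′

  _⇒_ : ∀ {Δ} → Proc Δ → Proc Δ → Set
  _⇒_ = Star _⟶_

  ----------------------------------------------------------------------
  -- Sets of lock names

  -- Names of sort bool are not counted, which implements the convention that
  -- "γ , ℓ" is γ when ℓ has sort bool.

  #locks : Ctx → ℕ
  #locks []           = zero
  #locks (bool ∷ Δ)   = #locks Δ
  #locks (lock _ ∷ Δ) = suc (#locks Δ)

  LockSet : Ctx → Set
  LockSet Δ = Subset (#locks Δ)

  index : ∀ {Δ L} → Δ ∋ lock L → Fin (#locks Δ)
  index Z                  = zero
  index (S {t = bool} x)   = index x
  index (S {t = lock _} x) = suc (index x)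

  extend : Side → ∀ {Δ} s → LockSet Δ → LockSet (s ∷ Δ)
  extend b bool     γ = γ
  extend b (lock _) γ = b ∷ γ

  -- "γ , x" for x the innermost name, and γ seen in the scope of x.

  with₀ wk : ∀ {Δ} s → LockSet Δ → LockSet (s ∷ Δ)
  with₀ = extend inside
  wk    = extend outside

  remove₀ : ∀ {Δ} s → LockSet (s ∷ Δ) → LockSet Δ
  remove₀ bool     γ = γ
  remove₀ (lock _) γ = tail γ

  ｛_｝ : ∀ {Δ L} → Δ ∋ lock L → LockSet Δ
  ｛ ℓ ｝ = ⁅ index ℓ ⁆

  flnVal : ∀ {Δ s} → Val Δ s → LockSet Δ
  flnVal {s = bool}   v        = ⊥
  flnVal {s = lock _} (name ℓ) = ｛ ℓ ｝

  fln : ∀ {Δ} → Proc Δ → LockSet Δ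
  fln {Δ} (acquire {L} ℓ P) = ｛ ℓ ｝ ∪ remove₀ {Δ} (Σ L) (fln P)
  fln (release ℓ v)         = ｛ ℓ ｝ ∪ flnVal v
  fln {Δ} (ν L P)           = remove₀ {Δ} (lock L) (fln P)
  fln (P ∥ Q)               = fln P ∪ fln Q
  fln 𝟎                     = ⊥
  fln (match v v′ P Q)      = flnVal v ∪ flnVal v′ ∪ fln P ∪ fln Q

  ----------------------------------------------------------------------
  -- Typing

  infix 4 _#_

  _#_ : ∀ {n} → Subset n → Subset n → Set
  γ₁ # γ₂ = Empty (γ₁ ∩ γ₂)

  -- A list of pairwise disjoint components represents the set of its members.
  -- The judgement below entails pairwise disjointness, and is closed under
  -- equality of the represented sets (rule Equ).

  Env : Ctx → Set
  Env Δ = List (LockSet Δ)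

  Disjoint : ∀ {n} → List (Subset n) → Set
  Disjoint = AllPairs _#_

  connect : ∀ {n} → Subset n → List (Subset n) → List (Subset n)
  connect γ Γ =
    (γ ∪ ⋃ (filter (λ γᵢ → nonempty? (γᵢ ∩ γ)) Γ)) ∷
    filter (λ γᵢ → ¬? (nonempty? (γᵢ ∩ γ))) Γ

  -- The graph of the partial operation •; the second premise of •-∷ says that
  -- connect (γ; Γ₃) is defined.

  infix 4 _•_≔_

  data _•_≔_ {n : ℕ} : (Γ₁ Γ₂ Γ : List (Subset n)) → Set where
    •-[] : ∀ {Γ} → [] • Γ ≔ Γ
    •-∷  : ∀ {γ Γ₁ Γ₂ Γ₃} → Γ₁ • Γ₂ ≔ Γ₃ → All (λ γᵢ → ∣ γ ∩ γᵢ ∣ ≤ 1) Γ₃ →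
           γ ∷ Γ₁ • Γ₂ ≔ connect γ Γ₃

  infix 3 _⨾_⊢_

  data _⨾_⊢_ : ∀ {Δ} → Env Δ → LockSet Δ → Proc Δ → Set where
    Acq : ∀ {Δ L} {ℓ : Δ ∋ lock L} {P : Proc (Σ L ∷ Δ)}
            {Γ : Env Δ} {γ R : LockSet Δ} →
          index ℓ ∉ γ → index ℓ ∉ R →
          with₀ {Δ} (Σ L) (γ ∪ ｛ ℓ ｝) ∷ map (wk {Δ} (Σ L)) Γ ⨾ wk {Δ} (Σ L) (R ∪ ｛ ℓ ｝) ⊢ P →
          (⋃ Γ ∪ (γ ∪ ｛ ℓ ｝)) ∷ [] ⨾ R ⊢ acquire ℓ P

    Rel : ∀ {Δ L} {ℓ : Δ ∋ lock L} {v : Val Δ (Σ L)} {Γ : Env Δ} {γ : LockSet Δ} →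
          index ℓ ∉ γ → flnVal v # (γ ∪ ｛ ℓ ｝) →
          Disjoint ((γ ∪ ｛ ℓ ｝ ∪ flnVal v) ∷ Γ) →
          (γ ∪ ｛ ℓ ｝ ∪ flnVal v) ∷ Γ ⨾ ｛ ℓ ｝ ⊢ release ℓ v

    New : ∀ {Δ L} {P : Proc (lock L ∷ Δ)} {Γ : Env Δ} {γ R : LockSet Δ} →
          with₀ {Δ} (lock L) γ ∷ map (wk {Δ} (lock L)) Γ ⨾ with₀ {Δ} (lock L) R ⊢ P →
          γ ∷ Γ ⨾ R ⊢ ν L P

    Par : ∀ {Δ} {P₁ P₂ : Proc Δ} {Γ₁ Γ₂ Γ : Env Δ} {R₁ R₂ : LockSet Δ} →
          Γ₁ ⨾ R₁ ⊢ P₁ → Γ₂ ⨾ R₂ ⊢ P₂ → Γ₁ • Γ₂ ≔ Γ → R₁ # R₂ →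
          Γ ⨾ R₁ ∪ R₂ ⊢ P₁ ∥ P₂

    Mat : ∀ {Δ s} {v v′ : Val Δ s} {P₁ P₂ : Proc Δ} {Γ : Env Δ} {R : LockSet Δ} →
          Γ ⨾ R ⊢ P₁ → Γ ⨾ R ⊢ P₂ → Γ ⨾ R ⊢ match v v′ P₁ P₂

    Nil : ∀ {Δ} {Γ : Env Δ} → Disjoint Γ → Γ ⨾ ⊥ ⊢ 𝟎 {Δ}

    Equ : ∀ {Δ} {P : Proc Δ} {Γ Γ′ : Env Δ} {R : LockSet Δ} →
          Γ ∼[ set ] Γ′ → Disjoint Γ′ → Γ ⨾ R ⊢ P → Γ′ ⨾ R ⊢ P

  ----------------------------------------------------------------------
  -- Deadlock

  Complete : ∀ {Δ} → Proc Δ → Set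
  Complete {Δ} P = ∃[ Γ ] _⨾_⊢_ {Δ} Γ (fln P) P

  data HasAcquire {Δ : Ctx} : Proc Δ → Set where
    here   : ∀ {L} {ℓ : Δ ∋ lock L} {P : Proc (Σ L ∷ Δ)} → HasAcquire (acquire ℓ P)
    under  : ∀ {L} {P : Proc (lock L ∷ Δ)} → HasAcquire P → HasAcquire (ν L P)
    ∥ˡ     : ∀ {P Q : Proc Δ} → HasAcquire P → HasAcquire (P ∥ Q)
    ∥ʳ     : ∀ {P Q : Proc Δ} → HasAcquire Q → HasAcquire (P ∥ Q)
    matchˡ : ∀ {s} {v v′ : Val Δ s} {P Q : Proc Δ} → HasAcquire P → HasAcquire (match v v′ P Q)
    matchʳ : ∀ {s} {v v′ : Val Δ s} {P Q : Proc Δ} → HasAcquire Q → HasAcquire (match v v′ P Q)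

  Stuck : ∀ {Δ} → Proc Δ → Set
  Stuck P = (∀ Q → P ≡ˢ Q → HasAcquire Q) × ¬ (∃[ P′ ] P ⟶ P′)

  Deadlocked : ∀ {Δ} → Proc Δ → Set
  Deadlocked P = Complete P × Stuck P

{-# OPTIONS --safe #-}

-- Only the typing of P′ itself matters, and it already excludes stuckness.  For
-- an irreducible typed process, every component γ of the environment either
-- contains a lock that is acquired at top level but whose release is not owned
-- (γ is waiting), or each owned lock of γ is released at top level (γ is
-- settled).  Since two composed components share at most one lock, a waiting
-- component stays waiting after composition: if the other side owns the awaited
-- lock without releasing it, then the other side is waiting for a lock that is
-- not shared.  In a complete process every acquired lock is owned, so no
-- component is waiting, and then no acquire is left at top level.

module Submission where

open import Defs
open import Data.Bool.Properties using () renaming (_≟_ to _≟ᵇ_)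
open import Data.Fin.Base using (Fin; zero; suc)
open import Data.Fin.Properties using (_≟_; suc-injective)
open import Data.Fin.Subset
  using (Subset; inside; _∈_; _∉_; _∩_; _∪_; _⊆_; ⋃; ∣_∣; Nonempty)
open import Data.Fin.Subset.Properties
  using (_∈?_; ∉⊥; x∈⁅x⁆; x∈⁅y⁆⇒x≡y; x∈p∪q⁺; x∈p∪q⁻; x∈p∩q⁺; x∈p∩q⁻; nonempty?;
         drop-there; ∣⁅x⁆∣≡1; p⊂q⇒∣p∣<∣q∣)
open import Data.List.Base using (List; []; _∷_; map; filter)
open import Data.List.Membership.Propositional using () renaming (_∈_ to _∈ˡ_)
open import Data.List.Membership.Propositional.Properties
  using (∈-filter⁺; ∈-filter⁻; ∈-map⁺; ∈-map⁻)
open import Data.List.Relation.Unary.All using (All)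
import Data.List.Relation.Unary.All as All
open import Data.List.Relation.Unary.Any using (here; there)
open import Data.Nat.Base using (ℕ; _≤_; _<_)
open import Data.Nat.Properties using (<⇒≱)
open import Data.Product.Base using (∃-syntax; _×_; _,_; proj₁; proj₂)
open import Data.Sum.Base using (_⊎_; inj₁; inj₂; [_,_]′)
import Data.Sum.Base as Sum
open import Data.Vec.Base using (_∷_; here; there)
open import Function.Base using (_∘_)
open import Function.Bundles using (Equivalence)
open import Relation.Binary.PropositionalEquality.Core
  using (_≡_; _≢_; refl; sym; cong; subst)
open import Relation.Nullary.Decidable using (Dec; yes; no; ¬?; map′)
open import Relation.Nullary.Negation.Core using (¬_; contradiction)

some⊎every : ∀ {A : Set} {P Q : A → Set} xs → (∀ {x} → x ∈ˡ xs → P x ⊎ Q x) →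
             (∃[ x ] x ∈ˡ xs × P x) ⊎ (∀ {x} → x ∈ˡ xs → Q x)
some⊎every []       _ = inj₂ λ ()
some⊎every (x ∷ xs) f with f (here refl) | some⊎every xs (f ∘ there)
... | inj₁ p | _                  = inj₁ (x , here refl , p)
... | inj₂ _ | inj₁ (y , y∈ , p) = inj₁ (y , there y∈ , p)
... | inj₂ q | inj₂ qs            = inj₂ λ { (here refl) → q ; (there x∈) → qs x∈ }

module Progress {𝕃 : Set} (Σ : 𝕃 → Sort 𝕃) where

  open πℓ Σ

  -- Components covering the owned locks, through `connect` and `•`.

  module _ {n : ℕ} where

    ∣p∣≤1⇒unique : ∀ {p : Subset n} {i j} → ∣ p ∣ ≤ 1 → i ∈ p → j ∈ p → i ≡ j
    ∣p∣≤1⇒unique {p} {i} {j} ∣p∣≤1 i∈p j∈p with i ≟ j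
    ... | yes i≡j = i≡j
    ... | no i≢j  = contradiction ∣p∣≤1 (<⇒≱ (subst (_< ∣ p ∣) (∣⁅x⁆∣≡1 i) (p⊂q⇒∣p∣<∣q∣
      ((λ k∈⁅i⁆ → subst (_∈ p) (sym (x∈⁅y⁆⇒x≡y i k∈⁅i⁆)) i∈p) ,
       j , j∈p , i≢j ∘ sym ∘ x∈⁅y⁆⇒x≡y i))))

    ∈-⋃⁺ : ∀ {i} {γ : Subset n} {Γ} → γ ∈ˡ Γ → i ∈ γ → i ∈ ⋃ Γ
    ∈-⋃⁺ (here refl) i∈γ = x∈p∪q⁺ (inj₁ i∈γ)
    ∈-⋃⁺ (there γ∈Γ) i∈γ = x∈p∪q⁺ (inj₂ (∈-⋃⁺ γ∈Γ i∈γ))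

    ∈-⋃⁻ : ∀ {i} (Γ : List (Subset n)) → i ∈ ⋃ Γ → ∃[ γ ] γ ∈ˡ Γ × i ∈ γ
    ∈-⋃⁻ []      i∈ = contradiction i∈ ∉⊥
    ∈-⋃⁻ (γ ∷ Γ) i∈ with x∈p∪q⁻ γ (⋃ Γ) i∈
    ... | inj₁ i∈γ = γ , here refl , i∈γ
    ... | inj₂ i∈⋃ with ∈-⋃⁻ Γ i∈⋃
    ...   | γ′ , γ′∈Γ , i∈γ′ = γ′ , there γ′∈Γ , i∈γ′

    _Covers_ : List (Subset n) → Subset n → Set
    Γ Covers O = ∀ {i} → i ∈ O → ∃[ γ ] γ ∈ˡ Γ × i ∈ γ

    meets? : (γ γᵢ : Subset n) → Dec (Nonempty (γᵢ ∩ γ))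
    meets? γ γᵢ = nonempty? (γᵢ ∩ γ)

    module _ (γ : Subset n) (Γ : List (Subset n)) where

      head-connect : Subset n
      head-connect = γ ∪ ⋃ (filter (meets? γ) Γ)

      ∈-head-connect : ∀ {γᵢ i j} → γᵢ ∈ˡ Γ → i ∈ γᵢ → i ∈ γ → j ∈ γᵢ → j ∈ head-connect
      ∈-head-connect γᵢ∈Γ i∈γᵢ i∈γ j∈γᵢ =
        x∈p∪q⁺ (inj₂ (∈-⋃⁺ (∈-filter⁺ (meets? γ) γᵢ∈Γ (_ , x∈p∩q⁺ (i∈γᵢ , i∈γ))) j∈γᵢ))

      connect-Covers : ∀ {O} → (∀ {i} → i ∈ O → i ∈ γ ⊎ ∃[ γᵢ ] γᵢ ∈ˡ Γ × i ∈ γᵢ) →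
                       connect γ Γ Covers O
      connect-Covers cov i∈O with cov i∈O
      ... | inj₁ i∈γ = _ , here refl , x∈p∪q⁺ (inj₁ i∈γ)
      ... | inj₂ (γᵢ , γᵢ∈Γ , i∈γᵢ) with meets? γ γᵢ
      ...   | yes m = _ , here refl , x∈p∪q⁺ (inj₂ (∈-⋃⁺ (∈-filter⁺ (meets? γ) γᵢ∈Γ m) i∈γᵢ))
      ...   | no ¬m = γᵢ , there (∈-filter⁺ (¬? ∘ meets? γ) γᵢ∈Γ ¬m) , i∈γᵢ

    -- Ownership at an intermediate stage of `•`, which absorbs the left components one at a time. A
    -- lock of `O₁` counts only once a component containing it has been absorbed; otherwise the
    -- environment composed so far need not cover it.
    owned : Subset n → Subset n → List (Subset n) → Subset n
    owned O₁ O₂ Γ₁ = (O₁ ∩ ⋃ Γ₁) ∪ O₂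

    module _ {O₁ O₂ : Subset n} where

      owned-[] : owned O₁ O₂ [] ⊆ O₂
      owned-[] i∈ with x∈p∪q⁻ (O₁ ∩ ⋃ []) O₂ i∈
      ... | inj₁ i∈∩  = contradiction (proj₂ (x∈p∩q⁻ O₁ _ i∈∩)) ∉⊥
      ... | inj₂ i∈O₂ = i∈O₂

      owned-∷ : ∀ {γ} Γ₁ {i} → i ∈ owned O₁ O₂ (γ ∷ Γ₁) →
                i ∈ owned O₁ O₂ Γ₁ ⊎ (i ∈ O₁ × i ∈ γ)
      owned-∷ {γ} Γ₁ i∈ with x∈p∪q⁻ (O₁ ∩ (γ ∪ ⋃ Γ₁)) O₂ i∈
      ... | inj₂ i∈O₂ = inj₁ (x∈p∪q⁺ (inj₂ i∈O₂))
      ... | inj₁ i∈∩ with x∈p∩q⁻ O₁ _ i∈∩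
      ...   | i∈O₁ , i∈⋃ with x∈p∪q⁻ γ (⋃ Γ₁) i∈⋃
      ...     | inj₁ i∈γ  = inj₂ (i∈O₁ , i∈γ)
      ...     | inj₂ i∈⋃₁ = inj₁ (x∈p∪q⁺ (inj₁ (x∈p∩q⁺ (i∈O₁ , i∈⋃₁))))

      •-Covers : ∀ {Γ₁ Γ₂ Γ} → Γ₁ • Γ₂ ≔ Γ → Γ₂ Covers O₂ → Γ Covers owned O₁ O₂ Γ₁
      •-Covers •-[] cov = cov ∘ owned-[]
      •-Covers (•-∷ {Γ₁ = Γ₁} c _) cov =
        connect-Covers _ _ (Sum.swap ∘ Sum.map (•-Covers c cov) proj₂ ∘ owned-∷ Γ₁)

      -- When all of `Γ₁` is absorbed, covering puts every lock of `O₁` inside `⋃ Γ₁`. This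
      -- inclusion suffices, as `Waiting` and `Decided` pass to smaller sets of owned locks.
      owned-⊇ : ∀ {Γ₁} → Γ₁ Covers O₁ → O₁ ∪ O₂ ⊆ owned O₁ O₂ Γ₁
      owned-⊇ cov i∈ with x∈p∪q⁻ O₁ O₂ i∈
      ... | inj₁ i∈O₁ = let _ , γ∈ , i∈γ = cov i∈O₁ in
        x∈p∪q⁺ (inj₁ (x∈p∩q⁺ (i∈O₁ , ∈-⋃⁺ γ∈ i∈γ)))
      ... | inj₂ i∈O₂ = x∈p∪q⁺ (inj₂ i∈O₂)

  -- A and T stand for the locks that are acquired, respectively released, at top
  -- level, and O for the owned locks.

  module State {n : ℕ} (A T : Fin n → Set) where

    Waiting Settled Decided : Subset n → Subset n → Set
    Waiting O γ = ∃[ i ] i ∈ γ × A i × i ∉ O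
    Settled O γ = ∀ {i} → i ∈ γ → i ∈ O → T i
    Decided O γ = Waiting O γ ⊎ Settled O γ

    Waiting-⊆ : ∀ {O O′ γ} → O ⊆ O′ → Waiting O′ γ → Waiting O γ
    Waiting-⊆ O⊆O′ (i , i∈γ , a , i∉O′) = i , i∈γ , a , i∉O′ ∘ O⊆O′

    Decided-⊆ : ∀ {O O′ γ} → O ⊆ O′ → Decided O′ γ → Decided O γ
    Decided-⊆ O⊆O′ = Sum.map (Waiting-⊆ O⊆O′) (λ settled i∈γ i∈O → settled i∈γ (O⊆O′ i∈O))

  -- Waiting and settled components under composition.

  module Composition {n : ℕ} {A T : Fin n → Set} (A∩T : ∀ {i} → A i → ¬ T i) where

    open State A T

    -- Γ is the environment composed so far and O₃ its owned locks; γ is the next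
    -- component of the left environment, whose owned locks are O₁.
    module _ {O O₁ O₃ γ : Subset n} {Γ : List (Subset n)}
             (split : ∀ {i} → i ∈ O → i ∈ O₃ ⊎ (i ∈ O₁ × i ∈ γ))
             (cov : Γ Covers O₃)
             (small : All (λ γᵢ → ∣ γ ∩ γᵢ ∣ ≤ 1) Γ)
             (decΓ : ∀ {γᵢ} → γᵢ ∈ˡ Γ → Decided O₃ γᵢ)
      where

      -- The awaited `i` may be owned on the other side. The component `γᵢ` holding it there is not
      -- settled, since `i` would be both acquired and released; so `γᵢ` waits for some `j`, which
      -- replaces `i` as witness.
      Waiting-head : Waiting O₁ γ → Waiting O (head-connect γ Γ)
      Waiting-head (i , i∈γ , a , i∉O₁) with i ∈? O₃
      ... | no i∉O₃  = i , x∈p∪q⁺ (inj₁ i∈γ) , a , [ i∉O₃ , i∉O₁ ∘ proj₁ ]′ ∘ split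
      ... | yes i∈O₃ with cov i∈O₃
      ...   | γᵢ , γᵢ∈Γ , i∈γᵢ with decΓ γᵢ∈Γ
      ...     | inj₂ settled = contradiction (settled i∈γᵢ i∈O₃) (A∩T a)
      ...     | inj₁ (j , j∈γᵢ , b , j∉O₃) =
        j , ∈-head-connect γ Γ γᵢ∈Γ i∈γᵢ i∈γ j∈γᵢ , b , [ j∉O₃ , j∉γ ∘ proj₂ ]′ ∘ split
        where
        -- The one place where the bound on shared locks is applied: `γ` and `γᵢ` already share `i`,
        -- so sharing `j` would give `i ≡ j`, but only `i` is in `O₃`.
        j∉γ : j ∉ γ
        j∉γ j∈γ = j∉O₃ (subst (_∈ O₃)
          (∣p∣≤1⇒unique (All.lookup small γᵢ∈Γ) (x∈p∩q⁺ (i∈γ , i∈γᵢ)) (x∈p∩q⁺ (j∈γ , j∈γᵢ))) i∈O₃)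

      -- If `γ` is settled, it cannot supply the awaited lock `j`: owning it would mean releasing
      -- it, while `j` is acquired.
      Waiting-absorbed : ∀ {γᵢ i} → Decided O₁ γ → γᵢ ∈ˡ Γ → i ∈ γᵢ → i ∈ γ →
                         Waiting O₃ γᵢ → Waiting O (head-connect γ Γ)
      Waiting-absorbed (inj₁ w) _ _ _ _ = Waiting-head w
      Waiting-absorbed (inj₂ settled) γᵢ∈Γ i∈γᵢ i∈γ (j , j∈γᵢ , a , j∉O₃) =
        j , ∈-head-connect γ Γ γᵢ∈Γ i∈γᵢ i∈γ j∈γᵢ , a ,
        [ j∉O₃ , (λ (j∈O₁ , j∈γ) → A∩T a (settled j∈γ j∈O₁)) ]′ ∘ split

      untouched : ∀ {γᵢ i} → ¬ Nonempty (γᵢ ∩ γ) → i ∈ γᵢ → i ∈ O → i ∈ O₃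
      untouched ¬m i∈γᵢ i∈O with split i∈O
      ... | inj₁ i∈O₃      = i∈O₃
      ... | inj₂ (_ , i∈γ) = contradiction (_ , x∈p∩q⁺ (i∈γᵢ , i∈γ)) ¬m

      Waiting-connect : ∀ {γᵢ} → Decided O₁ γ → γᵢ ∈ˡ Γ → Waiting O₃ γᵢ →
                        ∃[ γ′ ] γ′ ∈ˡ connect γ Γ × Waiting O γ′
      Waiting-connect {γᵢ} d γᵢ∈Γ w with meets? γ γᵢ
      ... | yes (_ , m) = let i∈γᵢ , i∈γ = x∈p∩q⁻ γᵢ γ m in
        _ , here refl , Waiting-absorbed d γᵢ∈Γ i∈γᵢ i∈γ w
      ... | no ¬m = let i , i∈γᵢ , a , i∉O₃ = w in
        γᵢ , there (∈-filter⁺ (¬? ∘ meets? γ) γᵢ∈Γ ¬m) , i , i∈γᵢ , a , i∉O₃ ∘ untouched ¬m i∈γᵢ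

      Settled-head : Settled O₁ γ → (∀ {γᵢ} → γᵢ ∈ˡ filter (meets? γ) Γ → Settled O₃ γᵢ) →
                     Settled O (head-connect γ Γ)
      Settled-head settled settledF i∈head i∈O with split i∈O
      ... | inj₂ (i∈O₁ , i∈γ) = settled i∈γ i∈O₁
      ... | inj₁ i∈O₃ with x∈p∪q⁻ γ _ i∈head
      -- By `cov`, a lock of `γ` owned on the other side also lies in a component of `Γ`; that
      -- component meets `γ`, so it is among the absorbed, settled ones.
      ...   | inj₁ i∈γ = let γᵢ , γᵢ∈Γ , i∈γᵢ = cov i∈O₃ in
        settledF (∈-filter⁺ (meets? γ) γᵢ∈Γ (_ , x∈p∩q⁺ (i∈γᵢ , i∈γ))) i∈γᵢ i∈O₃
      ...   | inj₂ i∈⋃ = let γᵢ , γᵢ∈F , i∈γᵢ = ∈-⋃⁻ (filter (meets? γ) Γ) i∈⋃ in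
        settledF γᵢ∈F i∈γᵢ i∈O₃

      -- Waiting dominates: one waiting part makes the merged component wait, and otherwise all
      -- parts are settled.
      Decided-head : Decided O₁ γ → Decided O (head-connect γ Γ)
      Decided-head (inj₁ w) = inj₁ (Waiting-head w)
      Decided-head d@(inj₂ settled)
        with some⊎every (filter (meets? γ) Γ) (decΓ ∘ proj₁ ∘ ∈-filter⁻ (meets? γ) {xs = Γ})
      ... | inj₂ settledF = inj₂ (Settled-head settled settledF)
      ... | inj₁ (γᵢ , γᵢ∈F , w) with ∈-filter⁻ (meets? γ) {xs = Γ} γᵢ∈F
      ...   | γᵢ∈Γ , _ , m = let i∈γᵢ , i∈γ = x∈p∩q⁻ γᵢ γ m in
        inj₁ (Waiting-absorbed d γᵢ∈Γ i∈γᵢ i∈γ w)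

      Decided-connect : Decided O₁ γ → ∀ {γ′} → γ′ ∈ˡ connect γ Γ → Decided O γ′
      Decided-connect d (here refl) = Decided-head d
      Decided-connect d (there γᵢ∈F) with ∈-filter⁻ (¬? ∘ meets? γ) {xs = Γ} γᵢ∈F
      ... | γᵢ∈Γ , ¬m with decΓ γᵢ∈Γ
      ...   | inj₁ (i , i∈γᵢ , a , i∉O₃) = inj₁ (i , i∈γᵢ , a , i∉O₃ ∘ untouched ¬m i∈γᵢ)
      ...   | inj₂ settled = inj₂ λ i∈γᵢ i∈O → settled i∈γᵢ (untouched ¬m i∈γᵢ i∈O)

    module _ {O₁ O₂ : Subset n} where

      •-Decided : ∀ {Γ₁ Γ₂ Γ} → Γ₁ • Γ₂ ≔ Γ → Γ₂ Covers O₂ →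
                  (∀ {γ} → γ ∈ˡ Γ₁ → Decided O₁ γ) → (∀ {γ} → γ ∈ˡ Γ₂ → Decided O₂ γ) →
                  ∀ {γ} → γ ∈ˡ Γ → Decided (owned O₁ O₂ Γ₁) γ
      •-Decided •-[] _ _ dec₂ γ∈ = Decided-⊆ owned-[] (dec₂ γ∈)
      •-Decided (•-∷ {Γ₁ = Γ₁} c small) cov dec₁ dec₂ =
        Decided-connect (owned-∷ Γ₁) (•-Covers c cov) small
          (•-Decided c cov (dec₁ ∘ there) dec₂) (dec₁ (here refl))

      -- A waiting component is followed through the successive calls of `connect`: `Waiting-head`
      -- treats it when it is the one being absorbed, `Waiting-connect` when it is already in the
      -- accumulated environment.
      •-Waiting : ∀ {Γ₁ Γ₂ Γ} → Γ₁ • Γ₂ ≔ Γ → Γ₂ Covers O₂ →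
                  (∀ {γ} → γ ∈ˡ Γ₁ → Decided O₁ γ) → (∀ {γ} → γ ∈ˡ Γ₂ → Decided O₂ γ) →
                  (∃[ γ ] γ ∈ˡ Γ₁ × Waiting O₁ γ) ⊎ (∃[ γ ] γ ∈ˡ Γ₂ × Waiting O₂ γ) →
                  ∃[ γ ] γ ∈ˡ Γ × Waiting (owned O₁ O₂ Γ₁) γ
      •-Waiting •-[] _ _ _ (inj₂ (γ , γ∈ , w)) = γ , γ∈ , Waiting-⊆ owned-[] w
      •-Waiting (•-∷ {γ} {Γ₁} {Γ₂} {Γ₃} c small) cov dec₁ dec₂ = [ fromΓ₁ , step ∘ inj₂ ]′
        where
        dec₃ : ∀ {γ} → γ ∈ˡ Γ₃ → Decided (owned O₁ O₂ Γ₁) γ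
        dec₃ = •-Decided c cov (dec₁ ∘ there) dec₂

        step : (∃[ γ ] γ ∈ˡ Γ₁ × Waiting O₁ γ) ⊎ (∃[ γ ] γ ∈ˡ Γ₂ × Waiting O₂ γ) →
               ∃[ γ′ ] γ′ ∈ˡ connect γ Γ₃ × Waiting (owned O₁ O₂ (γ ∷ Γ₁)) γ′
        step w = let _ , γᵢ∈Γ₃ , wᵢ = •-Waiting c cov (dec₁ ∘ there) dec₂ w in
          Waiting-connect (owned-∷ Γ₁) (•-Covers c cov) small dec₃ (dec₁ (here refl)) γᵢ∈Γ₃ wᵢ

        fromΓ₁ : ∃[ γ′ ] γ′ ∈ˡ γ ∷ Γ₁ × Waiting O₁ γ′ →
                 ∃[ γ′ ] γ′ ∈ˡ connect γ Γ₃ × Waiting (owned O₁ O₂ (γ ∷ Γ₁)) γ′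
        fromΓ₁ (_ , here refl , w) =
          _ , here refl , Waiting-head (owned-∷ Γ₁) (•-Covers c cov) small dec₃ w
        fromΓ₁ (γ′ , there γ′∈ , w) = step (inj₁ (γ′ , γ′∈ , w))

  -- Reductions and barbs

  Reduces : ∀ {Δ} → Proc Δ → Set
  Reduces P = ∃[ P′ ] P ⟶ P′

  Reduces-≡ˢ : ∀ {Δ} {P Q : Proc Δ} → P ≡ˢ Q → Reduces Q → Reduces P
  Reduces-≡ˢ P≡Q (Q′ , r) = Q′ , struct P≡Q r ≈-refl

  Reduces-∥ˡ : ∀ {Δ} {P Q : Proc Δ} → Reduces P → Reduces (P ∥ Q)
  Reduces-∥ˡ (P′ , r) = _ , par r

  Reduces-∥ʳ : ∀ {Δ} {P Q : Proc Δ} → Reduces Q → Reduces (P ∥ Q)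
  Reduces-∥ʳ = Reduces-≡ˢ ∥-comm ∘ Reduces-∥ˡ

  Reduces-ν : ∀ {Δ L} {P : Proc (lock L ∷ Δ)} → Reduces P → Reduces (ν L P)
  Reduces-ν (P′ , r) = _ , res r

  ∥-congʳ : ∀ {Δ} {P Q T : Proc Δ} → P ≡ˢ Q → T ∥ P ≡ˢ T ∥ Q
  ∥-congʳ P≡Q = ≈-trans ∥-comm (≈-trans (∥-cong P≡Q) ∥-comm)

  S-injective : ∀ {Δ s t} {x y : Δ ∋ s} → S {t = t} x ≡ S y → x ≡ y
  S-injective refl = refl

  name-injective : ∀ {Δ s} {x y : Δ ∋ s} → name x ≡ name y → x ≡ y
  name-injective refl = refl

  _≟ᴺ_ : ∀ {Δ s} (x y : Δ ∋ s) → Dec (x ≡ y)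
  Z   ≟ᴺ Z   = yes refl
  Z   ≟ᴺ S y = no λ ()
  S x ≟ᴺ Z   = no λ ()
  S x ≟ᴺ S y = map′ (cong S) S-injective (x ≟ᴺ y)

  _≟ⱽ_ : ∀ {Δ s} (v w : Val Δ s) → Dec (v ≡ w)
  name x ≟ⱽ name y = map′ (cong name) name-injective (x ≟ᴺ y)
  name x ≟ⱽ lit c  = no λ ()
  lit b  ≟ⱽ name y = no λ ()
  lit b  ≟ⱽ lit c  = map′ (cong lit) (λ { refl → refl }) (b ≟ᵇ c)

  Injective : ∀ {Δ Δ′} → Ren Δ Δ′ → Set
  Injective {Δ} ρ = ∀ {s} {x y : Δ ∋ s} → ρ x ≡ ρ y → x ≡ y

  extᴿ-injective : ∀ {Δ Δ′ t} {ρ : Ren Δ Δ′} → Injective ρ → Injective (extᴿ {t = t} ρ)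
  extᴿ-injective inj {x = Z}   {Z}   _  = refl
  extᴿ-injective inj {x = S x} {S y} eq = cong S (inj (S-injective eq))

  renVal-injective : ∀ {Δ Δ′ s} {ρ : Ren Δ Δ′} → Injective ρ →
                     {v w : Val Δ s} → renVal ρ v ≡ renVal ρ w → v ≡ w
  renVal-injective inj {name x} {name y} eq   = cong name (inj (name-injective eq))
  renVal-injective inj {lit b}  {lit b}  refl = refl

  data Kind : Set where
    acq rel : Kind

  infix 4 _↓⟨_⟩_

  -- The barbs of process calculi, refined by `match`: only the branch selected by the comparison is
  -- at top level.
  data _↓⟨_⟩_ {Δ : Ctx} : Proc Δ → Kind → ∀ {L} → Δ ∋ lock L → Set where
    ↓-acq : ∀ {L} {ℓ : Δ ∋ lock L} {P} → acquire ℓ P ↓⟨ acq ⟩ ℓ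
    ↓-rel : ∀ {L} {ℓ : Δ ∋ lock L} {v} → release ℓ v ↓⟨ rel ⟩ ℓ
    ↓-ν   : ∀ {k L L′} {ℓ : Δ ∋ lock L} {P : Proc (lock L′ ∷ Δ)} →
            P ↓⟨ k ⟩ S ℓ → ν L′ P ↓⟨ k ⟩ ℓ
    ↓-∥ˡ  : ∀ {k L} {ℓ : Δ ∋ lock L} {P Q} → P ↓⟨ k ⟩ ℓ → P ∥ Q ↓⟨ k ⟩ ℓ
    ↓-∥ʳ  : ∀ {k L} {ℓ : Δ ∋ lock L} {P Q} → Q ↓⟨ k ⟩ ℓ → P ∥ Q ↓⟨ k ⟩ ℓ
    ↓-≡   : ∀ {k L s} {ℓ : Δ ∋ lock L} {v : Val Δ s} {P Q} →
            P ↓⟨ k ⟩ ℓ → match v v P Q ↓⟨ k ⟩ ℓ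
    ↓-≢   : ∀ {k L s} {ℓ : Δ ∋ lock L} {v w : Val Δ s} {P Q} → v ≢ w →
            Q ↓⟨ k ⟩ ℓ → match v w P Q ↓⟨ k ⟩ ℓ

  -- Injectivity keeps distinct values distinct, so a mismatch still selects the second branch.
  ren-↓ : ∀ {Δ Δ′ k L} {ρ : Ren Δ Δ′} {ℓ : Δ ∋ lock L} {P} → Injective ρ →
          P ↓⟨ k ⟩ ℓ → ren ρ P ↓⟨ k ⟩ ρ ℓ
  ren-↓ inj ↓-acq       = ↓-acq
  ren-↓ inj ↓-rel       = ↓-rel
  ren-↓ inj (↓-ν b)     = ↓-ν (ren-↓ (extᴿ-injective inj) b)
  ren-↓ inj (↓-∥ˡ b)    = ↓-∥ˡ (ren-↓ inj b)
  ren-↓ inj (↓-∥ʳ b)    = ↓-∥ʳ (ren-↓ inj b)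
  ren-↓ inj (↓-≡ b)     = ↓-≡ (ren-↓ inj b)
  ren-↓ inj (↓-≢ v≢w b) = ↓-≢ (v≢w ∘ renVal-injective inj) (ren-↓ inj b)

  -- The context of the release is peeled off by structural congruence until `comm` applies; scope
  -- extrusion weakens the acquire, which is why its continuation is arbitrary.
  acquire-∥-Reduces : ∀ {Δ L} {ℓ : Δ ∋ lock L} {P Q} → Q ↓⟨ rel ⟩ ℓ → Reduces (acquire ℓ P ∥ Q)
  acquire-∥-Reduces ↓-rel       = Reduces-≡ˢ ∥-comm (_ , comm)
  acquire-∥-Reduces (↓-ν b)     = Reduces-≡ˢ ∥-ν (Reduces-ν (acquire-∥-Reduces b))
  acquire-∥-Reduces (↓-∥ˡ b)    = Reduces-≡ˢ ∥-assoc (Reduces-∥ˡ (acquire-∥-Reduces b))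
  acquire-∥-Reduces (↓-∥ʳ b)    =
    Reduces-≡ˢ (≈-trans (∥-congʳ ∥-comm) ∥-assoc) (Reduces-∥ˡ (acquire-∥-Reduces b))
  acquire-∥-Reduces (↓-≡ b)     = Reduces-≡ˢ (∥-congʳ match-≡) (acquire-∥-Reduces b)
  acquire-∥-Reduces (↓-≢ v≢w b) = Reduces-≡ˢ (∥-congʳ (match-≢ v≢w)) (acquire-∥-Reduces b)

  -- The context of the acquire is peeled off first; when a restriction is crossed, the release barb
  -- is weakened by `ren-↓`.
  ∥-Reduces : ∀ {Δ L} {ℓ : Δ ∋ lock L} {P Q} → P ↓⟨ acq ⟩ ℓ → Q ↓⟨ rel ⟩ ℓ → Reduces (P ∥ Q)
  ∥-Reduces ↓-acq       r = acquire-∥-Reduces r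
  ∥-Reduces (↓-ν b)     r =
    Reduces-≡ˢ (≈-trans ∥-comm ∥-ν)
      (Reduces-ν (Reduces-≡ˢ ∥-comm (∥-Reduces b (ren-↓ S-injective r))))
  ∥-Reduces (↓-∥ˡ b)    r =
    Reduces-≡ˢ (≈-trans (∥-cong ∥-comm) (≈-sym ∥-assoc)) (Reduces-∥ʳ (∥-Reduces b r))
  ∥-Reduces (↓-∥ʳ b)    r = Reduces-≡ˢ (≈-sym ∥-assoc) (Reduces-∥ʳ (∥-Reduces b r))
  ∥-Reduces (↓-≡ b)     r = Reduces-≡ˢ (∥-cong match-≡) (∥-Reduces b r)
  ∥-Reduces (↓-≢ v≢w b) r = Reduces-≡ˢ (∥-cong (match-≢ v≢w)) (∥-Reduces b r)

  -- Both barbs follow the same path, including the choice of match branches, down to the parallel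
  -- composition where they separate.
  acq∧rel⇒Reduces : ∀ {Δ L} {ℓ : Δ ∋ lock L} {P} → P ↓⟨ acq ⟩ ℓ → P ↓⟨ rel ⟩ ℓ → Reduces P
  acq∧rel⇒Reduces (↓-ν a)     (↓-ν r)     = Reduces-ν (acq∧rel⇒Reduces a r)
  acq∧rel⇒Reduces (↓-∥ˡ a)    (↓-∥ˡ r)    = Reduces-∥ˡ (acq∧rel⇒Reduces a r)
  acq∧rel⇒Reduces (↓-∥ˡ a)    (↓-∥ʳ r)    = ∥-Reduces a r
  acq∧rel⇒Reduces (↓-∥ʳ a)    (↓-∥ˡ r)    = Reduces-≡ˢ ∥-comm (∥-Reduces a r)
  acq∧rel⇒Reduces (↓-∥ʳ a)    (↓-∥ʳ r)    = Reduces-∥ʳ (acq∧rel⇒Reduces a r)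
  acq∧rel⇒Reduces (↓-≡ a)     (↓-≡ r)     = Reduces-≡ˢ match-≡ (acq∧rel⇒Reduces a r)
  acq∧rel⇒Reduces (↓-≡ a)     (↓-≢ v≢v r) = contradiction refl v≢v
  acq∧rel⇒Reduces (↓-≢ v≢v a) (↓-≡ r)     = contradiction refl v≢v
  acq∧rel⇒Reduces (↓-≢ v≢w a) (↓-≢ _ r)   = Reduces-≡ˢ (match-≢ v≢w) (acq∧rel⇒Reduces a r)

  index-injective : ∀ {Δ L L′} (x : Δ ∋ lock L) (y : Δ ∋ lock L′) → index x ≡ index y →
                    (L , x) ≡ (L′ , y)
  index-injective Z Z _ = refl
  index-injective (S {t = bool} x) (S y) eq with index-injective x y eq
  ... | refl = refl
  index-injective (S {t = lock _} x) (S y) eq with index-injective x y (suc-injective eq)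
  ... | refl = refl

  Barb : ∀ {Δ} → Kind → Proc Δ → Fin (#locks Δ) → Set
  Barb {Δ} k P i = ∃[ L ] ∃[ ℓ ] index {Δ} {L} ℓ ≡ i × P ↓⟨ k ⟩ ℓ

  -- Lock sets see only indices, so `index-injective` must first identify the two names together
  -- with their sorts.
  Barb-disjoint : ∀ {Δ} {P : Proc Δ} → ¬ Reduces P → ∀ {i} → Barb acq P i → ¬ Barb rel P i
  Barb-disjoint irr (_ , x , refl , a) (_ , y , eq , r) with index-injective y x eq
  ... | refl = irr (acq∧rel⇒Reduces a r)

  Barb-map : ∀ {Δ k} {P Q : Proc Δ} → (∀ {L} {ℓ : Δ ∋ lock L} → P ↓⟨ k ⟩ ℓ → Q ↓⟨ k ⟩ ℓ) →
             ∀ {i} → Barb k P i → Barb k Q i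
  Barb-map f (L , ℓ , eq , b) = L , ℓ , eq , f b

  Barb-ν : ∀ {Δ k L} {P : Proc (lock L ∷ Δ)} {i} → Barb k P (suc i) → Barb k (ν L P) i
  Barb-ν (L , S ℓ , eq , b) = L , ℓ , suc-injective eq , ↓-ν b

  lift : ∀ {Δ} s → Fin (#locks Δ) → Fin (#locks (s ∷ Δ))
  lift bool     i = i
  lift (lock _) i = suc i

  lift-extend⁺ : ∀ {Δ b} s {i} {γ : LockSet Δ} → i ∈ γ → lift {Δ} s i ∈ extend b {Δ} s γ
  lift-extend⁺ bool     i∈ = i∈
  lift-extend⁺ (lock _) i∈ = there i∈

  lift-extend⁻ : ∀ {Δ b} s {i} {γ : LockSet Δ} → lift {Δ} s i ∈ extend b {Δ} s γ → i ∈ γ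
  lift-extend⁻ bool     i∈ = i∈
  lift-extend⁻ (lock _) i∈ = drop-there i∈

  -- Completeness enters here: with `fln P` as the owned locks, no acquire barb is unowned.
  ∈-fln : ∀ {Δ k L} {ℓ : Δ ∋ lock L} {P} → P ↓⟨ k ⟩ ℓ → index ℓ ∈ fln P
  ∈-fln ↓-acq     = x∈p∪q⁺ (inj₁ (x∈⁅x⁆ _))
  ∈-fln ↓-rel     = x∈p∪q⁺ (inj₁ (x∈⁅x⁆ _))
  ∈-fln (↓-ν {P = P} b) with fln P | ∈-fln b
  ... | _ ∷ _ | there i∈ = i∈
  ∈-fln (↓-∥ˡ b)  = x∈p∪q⁺ (inj₁ (∈-fln b))
  ∈-fln (↓-∥ʳ b)  = x∈p∪q⁺ (inj₂ (∈-fln b))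
  ∈-fln (↓-≡ {v = v} b) =
    x∈p∪q⁺ {p = flnVal v} (inj₂ (x∈p∪q⁺ {p = flnVal v} (inj₂ (x∈p∪q⁺ (inj₁ (∈-fln b))))))
  ∈-fln (↓-≢ {v = v} {w} _ b) =
    x∈p∪q⁺ {p = flnVal v} (inj₂ (x∈p∪q⁺ {p = flnVal w} (inj₂ (x∈p∪q⁺ (inj₂ (∈-fln b))))))

  -- Typed processes

  -- Typing grants ownership only of locks present in the environment. Composition relies on this to
  -- locate a lock owned by the other side.
  ⊢-Covers : ∀ {Δ} {Γ : Env Δ} {R} {P : Proc Δ} → Γ ⨾ R ⊢ P → Γ Covers R
  ⊢-Covers {Δ} (Acq {L = L} {Γ = Γ} _ _ d) i∈R
    with ⊢-Covers d (lift-extend⁺ {Δ} (Σ L) (x∈p∪q⁺ (inj₁ i∈R)))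
  ... | _ , here refl , i∈γ = _ , here refl , x∈p∪q⁺ (inj₂ (lift-extend⁻ {Δ} (Σ L) i∈γ))
  ... | _ , there γ∈ , i∈γ with ∈-map⁻ (wk {Δ} (Σ L)) γ∈
  ...   | _ , γ∈Γ , refl =
    _ , here refl , x∈p∪q⁺ (inj₁ (∈-⋃⁺ γ∈Γ (lift-extend⁻ {Δ} (Σ L) i∈γ)))
  ⊢-Covers (Rel {γ = γ} _ _ _) i∈ = _ , here refl , x∈p∪q⁺ {p = γ} (inj₂ (x∈p∪q⁺ (inj₁ i∈)))
  ⊢-Covers {Δ} (New {L = L} d) i∈R with ⊢-Covers d (there i∈R)
  ... | _ , here refl , i∈γ = _ , here refl , drop-there i∈γ
  ... | _ , there γ∈ , i∈γ with ∈-map⁻ (wk {Δ} (lock L)) γ∈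
  ...   | _ , γ∈Γ , refl = _ , there γ∈Γ , drop-there i∈γ
  ⊢-Covers (Par d₁ d₂ c _) i∈ =
    •-Covers c (⊢-Covers d₂) (owned-⊇ (⊢-Covers d₁) i∈)
  ⊢-Covers (Mat d _) = ⊢-Covers d
  ⊢-Covers (Nil _) i∈ = contradiction i∈ ∉⊥
  ⊢-Covers (Equ eq _ d) i∈R = let γ , γ∈ , i∈γ = ⊢-Covers d i∈R in
    γ , Equivalence.to eq γ∈ , i∈γ

  -- A witness against the first half of `Stuck`. Working up to `≡ˢ` discards the unselected
  -- branches of matches, which may contain acquires.
  Inert : ∀ {Δ} → Proc Δ → Set
  Inert P = ∃[ Q ] P ≡ˢ Q × ¬ HasAcquire Q

  Inert-≡ˢ : ∀ {Δ} {P Q : Proc Δ} → P ≡ˢ Q → Inert Q → Inert P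
  Inert-≡ˢ P≡Q (T , Q≡T , ¬acq) = T , ≈-trans P≡Q Q≡T , ¬acq

  Inert-∥ : ∀ {Δ} {P Q : Proc Δ} → Inert P → Inert Q → Inert (P ∥ Q)
  Inert-∥ (P′ , P≡P′ , ¬acqP) (Q′ , Q≡Q′ , ¬acqQ) =
    P′ ∥ Q′ , ≈-trans (∥-cong P≡P′) (∥-congʳ Q≡Q′) , λ { (∥ˡ a) → ¬acqP a ; (∥ʳ a) → ¬acqQ a }

  Inert-ν : ∀ {Δ L} {P : Proc (lock L ∷ Δ)} → Inert P → Inert (ν L P)
  Inert-ν (Q , P≡Q , ¬acq) = ν _ Q , ν-cong P≡Q , λ { (under a) → ¬acq a }

  module Top {Δ : Ctx} (P : Proc Δ) = State (Barb acq P) (Barb rel P)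

  Waiting-map : ∀ {Δ} {P Q : Proc Δ} {R γ} →
                (∀ {k L} {ℓ : Δ ∋ lock L} → P ↓⟨ k ⟩ ℓ → Q ↓⟨ k ⟩ ℓ) →
                Top.Waiting P R γ → Top.Waiting Q R γ
  Waiting-map f (i , i∈γ , a , i∉R) = i , i∈γ , Barb-map f a , i∉R

  Decided-map : ∀ {Δ} {P Q : Proc Δ} {R γ} →
                (∀ {k L} {ℓ : Δ ∋ lock L} → P ↓⟨ k ⟩ ℓ → Q ↓⟨ k ⟩ ℓ) →
                Top.Decided P R γ → Top.Decided Q R γ
  Decided-map f = Sum.map (Waiting-map f) λ settled i∈γ i∈R → Barb-map f (settled i∈γ i∈R)

  -- The restricted lock is owned, so the awaited one is another lock and remains visible outside.
  Waiting-ν : ∀ {Δ L b} {P : Proc (lock L ∷ Δ)} {R γ : LockSet Δ} →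
              Top.Waiting P (inside ∷ R) (b ∷ γ) → Top.Waiting (ν L P) R γ
  Waiting-ν (zero  , _         , _ , 0∉) = contradiction here 0∉
  Waiting-ν (suc i , there i∈γ , a , i∉) = i , i∈γ , Barb-ν a , i∉ ∘ there

  Decided-ν : ∀ {Δ L b} {P : Proc (lock L ∷ Δ)} {R γ : LockSet Δ} →
              Top.Decided P (inside ∷ R) (b ∷ γ) → Top.Decided (ν L P) R γ
  Decided-ν = Sum.map Waiting-ν λ settled i∈γ i∈R → Barb-ν (settled (there i∈γ) (there i∈R))

  -- An acquire waits for its own lock, a release owns just the lock it releases, and `𝟎` owns
  -- nothing. For `Par`, irreducibility makes acquire and release barbs disjoint, as `•-Decided`
  -- requires.
  ⊢-Decided : ∀ {Δ} {Γ : Env Δ} {R} {P : Proc Δ} → Γ ⨾ R ⊢ P → ¬ Reduces P →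
              ∀ {γ} → γ ∈ˡ Γ → Top.Decided P R γ
  ⊢-Decided (Acq {ℓ = ℓ} {γ = γ} _ ℓ∉R _) _ (here refl) =
    inj₁ (index ℓ , x∈p∪q⁺ (inj₂ (x∈p∪q⁺ {p = γ} (inj₂ (x∈⁅x⁆ _)))) , (_ , ℓ , refl , ↓-acq) , ℓ∉R)
  ⊢-Decided (Rel {ℓ = ℓ} _ _ _) _ _ =
    inj₂ λ _ i∈ → _ , ℓ , sym (x∈⁅y⁆⇒x≡y (index ℓ) i∈) , ↓-rel
  ⊢-Decided (New d) irr (here refl) = Decided-ν (⊢-Decided d (irr ∘ Reduces-ν) (here refl))
  ⊢-Decided {Δ} (New {L = L} d) irr (there γ∈) =
    Decided-ν (⊢-Decided d (irr ∘ Reduces-ν) (there (∈-map⁺ (wk {Δ} (lock L)) γ∈)))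
  ⊢-Decided {P = P} (Par d₁ d₂ c _) irr γ∈ =
    Top.Decided-⊆ P (owned-⊇ (⊢-Covers d₁))
      (Composition.•-Decided (Barb-disjoint irr) c (⊢-Covers d₂)
        (Decided-map ↓-∥ˡ ∘ ⊢-Decided d₁ (irr ∘ Reduces-∥ˡ))
        (Decided-map ↓-∥ʳ ∘ ⊢-Decided d₂ (irr ∘ Reduces-∥ʳ)) γ∈)
  ⊢-Decided (Mat {v = v} {v′} d₁ d₂) irr γ∈ with v ≟ⱽ v′
  ... | yes refl = Decided-map ↓-≡ (⊢-Decided d₁ (irr ∘ Reduces-≡ˢ match-≡) γ∈)
  ... | no v≢v′  = Decided-map (↓-≢ v≢v′) (⊢-Decided d₂ (irr ∘ Reduces-≡ˢ (match-≢ v≢v′)) γ∈)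
  ⊢-Decided (Nil _) _ _ = inj₂ λ _ i∈⊥ → contradiction i∈⊥ ∉⊥
  ⊢-Decided (Equ eq _ d) irr γ∈ = ⊢-Decided d irr (Equivalence.from eq γ∈)

  Blocked : ∀ {Δ} → Env Δ → LockSet Δ → Proc Δ → Set
  Blocked Γ R P = ∃[ γ ] γ ∈ˡ Γ × Top.Waiting P R γ

  Blocked-map : ∀ {Δ} {Γ : Env Δ} {R} {P Q : Proc Δ} →
                (∀ {k L} {ℓ : Δ ∋ lock L} → P ↓⟨ k ⟩ ℓ → Q ↓⟨ k ⟩ ℓ) →
                Blocked Γ R P → Blocked Γ R Q
  Blocked-map f (γ , γ∈ , w) = γ , γ∈ , Waiting-map f w

  Blocked-∥ : ∀ {Δ} {P₁ P₂ : Proc Δ} {Γ₁ Γ₂ Γ : Env Δ} {R₁ R₂} →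
              Γ₁ ⨾ R₁ ⊢ P₁ → Γ₂ ⨾ R₂ ⊢ P₂ → Γ₁ • Γ₂ ≔ Γ → ¬ Reduces (P₁ ∥ P₂) →
              Blocked Γ₁ R₁ P₁ ⊎ Blocked Γ₂ R₂ P₂ → Blocked Γ (R₁ ∪ R₂) (P₁ ∥ P₂)
  Blocked-∥ {P₁ = P₁} {P₂} d₁ d₂ c irr b =
    let γ , γ∈ , w = Composition.•-Waiting (Barb-disjoint irr) c (⊢-Covers d₂)
          (Decided-map ↓-∥ˡ ∘ ⊢-Decided d₁ (irr ∘ Reduces-∥ˡ))
          (Decided-map ↓-∥ʳ ∘ ⊢-Decided d₂ (irr ∘ Reduces-∥ʳ))
          (Sum.map (Blocked-map ↓-∥ˡ) (Blocked-map ↓-∥ʳ) b)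
    in γ , γ∈ , Top.Waiting-⊆ (P₁ ∥ P₂) (owned-⊇ (⊢-Covers d₁)) w

  -- `⊢-Decided` classifies components but does not show that settled ones leave no acquire. This
  -- second induction does: each top-level acquire creates a waiting component, and the outer
  -- constructors preserve the existence of one.
  ⊢-Blocked : ∀ {Δ} {Γ : Env Δ} {R} {P : Proc Δ} → Γ ⨾ R ⊢ P → ¬ Reduces P →
              Blocked Γ R P ⊎ Inert P
  ⊢-Blocked (Acq {ℓ = ℓ} {γ = γ} _ ℓ∉R _) _ = inj₁ (_ , here refl , index ℓ ,
    x∈p∪q⁺ (inj₂ (x∈p∪q⁺ {p = γ} (inj₂ (x∈⁅x⁆ _)))) , (_ , ℓ , refl , ↓-acq) , ℓ∉R)
  ⊢-Blocked (Rel _ _ _) _ = inj₂ (_ , ≈-refl , λ ())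
  ⊢-Blocked {Δ} (New {L = L} d) irr = Sum.map blocked Inert-ν (⊢-Blocked d (irr ∘ Reduces-ν))
    where
    blocked : Blocked _ _ _ → Blocked _ _ _
    blocked (_ , here refl , w) = _ , here refl , Waiting-ν w
    blocked (_ , there γ∈ , w) with ∈-map⁻ (wk {Δ} (lock L)) γ∈
    ... | _ , γ∈Γ , refl = _ , there γ∈Γ , Waiting-ν w
  ⊢-Blocked (Par d₁ d₂ c _) irr
    with ⊢-Blocked d₁ (irr ∘ Reduces-∥ˡ) | ⊢-Blocked d₂ (irr ∘ Reduces-∥ʳ)
  ... | inj₁ b₁ | _       = inj₁ (Blocked-∥ d₁ d₂ c irr (inj₁ b₁))
  ... | inj₂ _  | inj₁ b₂ = inj₁ (Blocked-∥ d₁ d₂ c irr (inj₂ b₂))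
  ... | inj₂ i₁ | inj₂ i₂ = inj₂ (Inert-∥ i₁ i₂)
  ⊢-Blocked (Mat {v = v} {v′} d₁ d₂) irr with v ≟ⱽ v′
  ... | yes refl = Sum.map (Blocked-map ↓-≡) (Inert-≡ˢ match-≡)
                     (⊢-Blocked d₁ (irr ∘ Reduces-≡ˢ match-≡))
  ... | no v≢v′  = Sum.map (Blocked-map (↓-≢ v≢v′)) (Inert-≡ˢ (match-≢ v≢v′))
                     (⊢-Blocked d₂ (irr ∘ Reduces-≡ˢ (match-≢ v≢v′)))
  ⊢-Blocked (Nil _) _ = inj₂ (_ , ≈-refl , λ ())
  ⊢-Blocked (Equ eq _ d) irr =
    Sum.map₁ (λ (γ , γ∈ , w) → γ , Equivalence.to eq γ∈ , w) (⊢-Blocked d irr)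

  ¬Deadlocked : ∀ {Δ} {P : Proc Δ} → ¬ Deadlocked P
  ¬Deadlocked ((_ , d) , hasAcquire , irr) with ⊢-Blocked d irr
  ... | inj₁ (_ , _ , _ , _ , (_ , _ , refl , a) , ∉fln) = ∉fln (∈-fln a)
  ... | inj₂ (Q , P≡Q , ¬acq)                           = ¬acq (hasAcquire Q P≡Q)

proposition11 : ∀ {𝕃 : Set} (Σ : 𝕃 → Sort 𝕃) → let open πℓ Σ in
    ∀ {Δ : Ctx} {P P′ : Proc Δ} {Γ : Env Δ} {R : LockSet Δ} →
    Γ ⨾ R ⊢ P → P ⇒ P′ → ¬ Deadlocked P′
proposition11 Σ _ _ = Progress.¬Deadlocked Σ
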